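{- Let $n$ be a positive integer and let $a,b$ be odd integers with $0<a<b<n/2$. There exists a self-complementary binary $(n,4n)$ code $C$ such that \[ \{i\in\{0,1,\ldots,n\}:A_i(C)\ne0\}=\{0,\ n/2\pm a,\ n/2\pm b,\ n/2,\ n\},\qquad A_{n/2}(C)=2n-2, \] and $C=C_1\cup C_2$ where each $C_i$ has distance distribution with $A_0(C_i)=1$, $A_{n/2}(C_i)=2n-2$, $A_n(C_i)=1$ and all other $A_j(C_i)=0$, if and only if there exists a pair of weakly unbiased Hadamard matrices $H,K$ of order $n$ with $\sigma(H,K)=\{2a,2b\}$.
   Context: A binary $(n,M)$ code is a subset of $\mathbb{Z}_2^n$ of size $M$; $A_i(C)=\frac{1}{|C|}|\{(x,x')\in C\times C: d(x,x')=i\}|$ with $d$ Hamming distance; $C$ is self-complementary if $x+\mathbf{1}\in C$ for all $x\in C$. A Hadamard matrix of order $n$ is an $n\times n$ $(\pm1)$-matrix $H$ with $HH^T=nI_n$. For Hadamard matrices $H,K$ with $a_{ij}$ the $(i,j)$-entry of $HK^T$, $\sigma(H,K)=\{|a_{ij}|: i,j\}$. $H,K$ are weakly unbiased if $a_{ij}\equiv 2\pmod 4$ for all $i,j$ and $|\sigma(H,K)|\le 2$, unbiased pairs (all $|a_{ij}|=\sqrt n$) being excluded, so $|\sigma(H,K)|=2$. -}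

module Defs where

open import Data.Nat using (ℕ; zero; suc; _+_; _*_; _∸_; _≤_; _<_; _≡ᵇ_)
open import Data.Bool using (Bool; true; false; not; if_then_else_; _≟_)
open import Data.Vec using (Vec; []; _∷_; map)
open import Data.List using (List; length)
open import Data.Nat.ListAction using (sum)
import Data.List as L
open import Data.List.Membership.Propositional using (_∈_)
open import Data.List.Relation.Unary.Unique.Propositional using (Unique)
open import Data.Integer using (ℤ; +_; -[1+_]; ∣_∣; _-_) renaming (_+_ to _+ℤ_; _*_ to _*ℤ_)
open import Data.Integer.Divisibility using () renaming (_∣_ to _∣ℤ_)
open import Data.Rational using (ℚ; _/_; 0ℚ)
open import Data.Fin using (Fin)
open import Data.Product using (Σ; _×_; ∃; ∃-syntax; _,_)
open import Data.Sum using (_⊎_)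
open import Relation.Binary.PropositionalEquality using (_≡_)
open import Relation.Nullary using (yes; no; ¬_)
import Data.Fin as Fin
open import Data.Empty using (⊥)

Word : ℕ → Set
Word n = Vec Bool n

complement : ∀ {n} → Word n → Word n
complement = map not

hamming : ∀ {n} → Word n → Word n → ℕ
hamming [] [] = 0
hamming (x ∷ xs) (y ∷ ys) with x ≟ y
... | yes _ = hamming xs ys
... | no _ = suc (hamming xs ys)

record Code (n M : ℕ) : Set where
  constructor mkCode
  field
    words  : List (Word n)
    unique : Unique words
    size   : length words ≡ M
open Code public

pairCount : ∀ {n} → ℕ → List (Word n) → ℕ
pairCount i C = sum (L.map (λ x → sum (L.map (λ y → if hamming x y ≡ᵇ i then 1 else 0) C)) C)

-- Distance distribution A_i(C) = |{(x,x') ∈ C × C : d(x,x') = i}| / |C|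
-- (a rational number; the empty code gets 0 by convention).
A : ∀ {n} → ℕ → List (Word n) → ℚ
A {n} i C with length C
... | zero  = 0ℚ
... | suc m = (+ pairCount i C) / suc m

ℕ→ℚ : ℕ → ℚ
ℕ→ℚ k = (+ k) / 1

SelfComplementary : ∀ {n} → List (Word n) → Set
SelfComplementary C = ∀ x → x ∈ C → complement x ∈ C

Matrix : ℕ → Set
Matrix n = Fin n → Fin n → ℤ

Σℤ : ∀ n → (Fin n → ℤ) → ℤ
Σℤ zero    f = + 0
Σℤ (suc n) f = f Fin.zero +ℤ Σℤ n (λ k → f (Fin.suc k))

_·ᵀ_ : ∀ {n} → Matrix n → Matrix n → Matrix n
(H ·ᵀ K) i j = Σℤ _ (λ k → H i k *ℤ K j k)

scaledId : ∀ n → Matrix n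
scaledId n i j with i Fin.≟ j
... | yes _ = + n
... | no _ = + 0

record IsHadamard (n : ℕ) (H : Matrix n) : Set where
  field
    entries : ∀ i j → (H i j ≡ + 1) ⊎ (H i j ≡ -[1+ 0 ])
    orthog  : ∀ i j → (H ·ᵀ H) i j ≡ scaledId n i j

_∈σ[_,_] : ∀ {n} → ℕ → Matrix n → Matrix n → Set
s ∈σ[ H , K ] = ∃[ i ] ∃[ j ] ∣ (H ·ᵀ K) i j ∣ ≡ s

-- Unbiased: all |a_ij| = √n, i.e. |a_ij|^2 = n.
Unbiased : ∀ {n} → Matrix n → Matrix n → Set
Unbiased {n} H K = ∀ i j → ∣ (H ·ᵀ K) i j ∣ * ∣ (H ·ᵀ K) i j ∣ ≡ n

WeaklyUnbiased : ∀ {n} → Matrix n → Matrix n → Set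
WeaklyUnbiased {n} H K =
  (∀ i j → (+ 4) ∣ℤ ((H ·ᵀ K) i j - + 2))
  × (∃[ s ] ∃[ t ] (∀ i j → (∣ (H ·ᵀ K) i j ∣ ≡ s) ⊎ (∣ (H ·ᵀ K) i j ∣ ≡ t)))
  × (Unbiased H K → ⊥)

σ≡ : ∀ {n} → Matrix n → Matrix n → ℕ → ℕ → Set
σ≡ H K u v = (∀ s → s ∈σ[ H , K ] → (s ≡ u) ⊎ (s ≡ v)) × u ∈σ[ H , K ] × v ∈σ[ H , K ]

-- 2·s for s ∈ {0, n/2 ± a, n/2 ± b, n/2, n}, i.e. the "doubled" distance set
-- {0, n ± 2a, n ± 2b, n, 2n}.
InDoubledSet : ℕ → ℕ → ℕ → ℕ → Set
InDoubledSet n a b t =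
  (t ≡ 0) ⊎ (t ≡ n ∸ 2 * a) ⊎ (t ≡ n + 2 * a) ⊎ (t ≡ n ∸ 2 * b)
  ⊎ (t ≡ n + 2 * b) ⊎ (t ≡ n) ⊎ (t ≡ 2 * n)

-- {i ∈ {0,…,n} : A_i(C) ≠ 0} = {0, n/2 ± a, n/2 ± b, n/2, n}  (as sets of
-- rationals): every i ≤ n has A_i(C) ≠ 0 iff 2i is in the doubled set, and
-- every element of the doubled set is 2i for some i ≤ n (so n/2 etc. are
-- integers in {0,…,n}).
DistanceSet : ∀ {n} → List (Word n) → ℕ → ℕ → Set
DistanceSet {n} C a b =
  (∀ i → i ≤ n → ((A i C ≡ 0ℚ → ⊥) → InDoubledSet n a b (2 * i))
               × (InDoubledSet n a b (2 * i) → A i C ≡ 0ℚ → ⊥))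
  × (∀ t → InDoubledSet n a b t → ∃[ i ] (i ≤ n × 2 * i ≡ t))

HalfDistribution : ∀ {n} → List (Word n) → Set
HalfDistribution {n} C =
  ∀ j → (j ≡ 0 → A j C ≡ ℕ→ℚ 1)
      × (2 * j ≡ n → A j C ≡ ℕ→ℚ (2 * n ∸ 2))
      × (j ≡ n → A j C ≡ ℕ→ℚ 1)
      × ((j ≡ 0 → ⊥) → (2 * j ≡ n → ⊥) → (j ≡ n → ⊥)
          → A j C ≡ 0ℚ)

Odd : ℕ → Set
Odd a = ∃[ k ] a ≡ suc (2 * k)

{-# OPTIONS --safe #-}

-- Words x, y correspond to ±1 vectors with inner product n − 2 d(x, y), whose absolute value
-- δ x y does not change when x or y is complemented.  A half of the code is exactly the set of
-- rows of a Hadamard matrix together with their negatives: the distance distribution forces its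
-- size to be 2n, forces every word to have its complement in it, and allows only distances 0, n/2
-- and n, so one word from each complementary pair gives n orthogonal rows.  Since |C| = 4n, the
-- halves are disjoint, and A_{n/2}(C) = 2n − 2 is already exhausted by the pairs within a half.
-- So distances between the halves are n/2 ± a or n/2 ± b, that is, the entries of H Kᵀ are
-- ±2a or ±2b.
module Submission where

open import Defs
open import Data.Nat using (ℕ; zero; suc; _+_; _<_; _≤_; _*_; _∸_; z≤n; s≤s; ∣_-_∣; _≡ᵇ_; ≢-nonZero)
open import Data.Nat.Properties
open import Data.Nat.ListAction using (sum)
open import Data.Nat.ListAction.Properties using (sum-++; sum-↭)
open import Data.Nat.Solver using (module +-*-Solver)
open import Data.Bool using (Bool; true; false; not; if_then_else_) renaming (_≟_ to _≟ᵇ_)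
open import Data.Bool.Properties using (not-involutive; not-¬; ¬-not)
open import Data.Fin using (Fin) renaming (zero to fzero; suc to fsuc)
import Data.Fin as Fin
open import Data.Vec using (Vec; []; _∷_)
import Data.Vec as Vec
import Data.Vec.Properties as Vec
open import Data.List using (List; []; _∷_; _++_; length; map; filter; tabulate; lookup)
open import Data.List.Properties using (length-map; length-++; length-tabulate; map-++; filter-complete)
open import Data.List.Membership.Propositional using (_∈_; _∉_)
open import Data.List.Membership.Propositional.Properties
open import Data.List.Membership.Propositional.Properties.WithK using (unique∧set⇒bag)
open import Data.List.Relation.Unary.Any using (here; there)
import Data.List.Relation.Unary.All as All
open import Data.List.Relation.Unary.AllPairs using ([]; _∷_)
open import Data.List.Relation.Unary.Unique.Propositional using (Unique)
import Data.List.Relation.Unary.Unique.Propositional.Properties as Unique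
open import Data.List.Relation.Binary.BagAndSetEquality using (∼bag⇒↭)
open import Data.List.Relation.Binary.Permutation.Propositional using (_↭_)
import Data.List.Relation.Binary.Permutation.Propositional.Properties as ↭
open import Data.Integer using (ℤ; -[1+_]; ∣_∣; _⊖_) renaming (+_ to pos; _+_ to _+ℤ_; _*_ to _*ℤ_; _-_ to _-ℤ_)
import Data.Integer.Properties as ℤ
open import Data.Integer.Divisibility using () renaming (_∣_ to _∣ℤ_)
open import Data.Nat.Divisibility using (divides)
open import Data.Rational using (0ℚ)
import Data.Rational.Properties as ℚ
open import Data.Rational.Unnormalised using (mkℚᵘ; *≡*)
import Data.Rational.Unnormalised.Properties as ℚᵘ
open import Data.Product using (_×_; ∃-syntax; Σ-syntax; _,_; proj₁; proj₂)
open import Data.Sum using (_⊎_; inj₁; inj₂; [_,_]′) renaming (map to ⊎-map)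
open import Function.Base using (_∘_; id; case_of_)
open import Function.Bundles using (_⇔_; mk⇔; Equivalence)
open import Relation.Binary.PropositionalEquality
  using (_≡_; _≢_; refl; sym; trans; cong; cong₂; subst; module ≡-Reasoning)
open import Relation.Nullary using (¬_; Dec; yes; no)
open import Relation.Nullary.Negation using (contradiction)

private variable
  X : Set
  n : ℕ

-- Sums of natural numbers over lists.

sum-map-cong : ∀ {f g : X → ℕ} xs → (∀ {x} → x ∈ xs → f x ≡ g x) → sum (map f xs) ≡ sum (map g xs)
sum-map-cong []       f≗g = refl
sum-map-cong (x ∷ xs) f≗g = cong₂ _+_ (f≗g (here refl)) (sum-map-cong xs (f≗g ∘ there))

sum-map-const : ∀ {f : X → ℕ} {k} xs → (∀ {x} → x ∈ xs → f x ≡ k) → sum (map f xs) ≡ length xs * k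
sum-map-const []       f≡k = refl
sum-map-const (x ∷ xs) f≡k = cong₂ _+_ (f≡k (here refl)) (sum-map-const xs (f≡k ∘ there))

sum-map-≡0 : ∀ {f : X → ℕ} xs → (∀ {x} → x ∈ xs → f x ≡ 0) → sum (map f xs) ≡ 0
sum-map-≡0 xs f≡0 = trans (sum-map-const xs f≡0) (*-zeroʳ (length xs))

sum-map-≡0⁻ : ∀ {f : X → ℕ} {x} xs → sum (map f xs) ≡ 0 → x ∈ xs → f x ≡ 0
sum-map-≡0⁻ {f = f} (y ∷ xs) eq (here refl) = m+n≡0⇒m≡0 (f y) eq
sum-map-≡0⁻ {f = f} (y ∷ xs) eq (there x∈) = sum-map-≡0⁻ xs (m+n≡0⇒n≡0 (f y) eq) x∈

sum-map-≢0⁻ : ∀ (f : X → ℕ) xs → sum (map f xs) ≢ 0 → ∃[ x ] (x ∈ xs × f x ≢ 0)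
sum-map-≢0⁻ f []       ≢0 = contradiction refl ≢0
sum-map-≢0⁻ f (x ∷ xs) ≢0 with f x ≟ 0
... | no fx≢0  = x , here refl , fx≢0
... | yes fx≡0 with y , y∈ , fy≢0 ← sum-map-≢0⁻ f xs (λ eq → ≢0 (cong₂ _+_ fx≡0 eq)) =
  y , there y∈ , fy≢0

sum-map-+ : ∀ (f g : X → ℕ) xs → sum (map f xs) + sum (map g xs) ≡ sum (map (λ x → f x + g x) xs)
sum-map-+ f g []       = refl
sum-map-+ f g (x ∷ xs) = trans
  (solve 4 (λ a b c d → (a :+ b) :+ (c :+ d) := (a :+ c) :+ (b :+ d)) refl
     (f x) (sum (map f xs)) (g x) (sum (map g xs)))
  (cong ((f x + g x) +_) (sum-map-+ f g xs))
  where open +-*-Solver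

sum-map≤length : ∀ {f : X → ℕ} xs → (∀ {x} → x ∈ xs → f x ≤ 1) → sum (map f xs) ≤ length xs
sum-map≤length []       f≤1 = z≤n
sum-map≤length (x ∷ xs) f≤1 = +-mono-≤ (f≤1 (here refl)) (sum-map≤length xs (f≤1 ∘ there))

-- With every term at most 1, a single zero term would make the sum fall short of the length. This
-- is the pigeonhole step behind closure under complement.
sum-map≡length⁻ : ∀ {f : X → ℕ} {x} xs → (∀ {x} → x ∈ xs → f x ≤ 1) →
                  sum (map f xs) ≡ length xs → x ∈ xs → f x ≢ 0
sum-map≡length⁻ {f = f} (y ∷ xs) f≤1 eq (here refl) fx≡0 =
  <-irrefl (trans (sym (cong (_+ sum (map f xs)) fx≡0)) eq) (s≤s (sum-map≤length xs (f≤1 ∘ there)))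
sum-map≡length⁻ {f = f} (y ∷ xs) f≤1 eq (there x∈) fx≡0 with f y in fy | f≤1 (here refl)
... | 0 | _ = <-irrefl eq (s≤s (sum-map≤length xs (f≤1 ∘ there)))
... | 1 | _ = sum-map≡length⁻ xs (f≤1 ∘ there) (suc-injective eq) x∈ fx≡0
... | suc (suc _) | s≤s ()

-- A function supported on the single point `z`: the case of counting words at distance 0 or `n`
-- from a fixed word, where only the word itself or its complement can contribute.
module _ {f : X → ℕ} {z : X} (f-off : ∀ {x} → x ≢ z → f x ≡ 0) where

  sum-map-point-∉ : ∀ xs → z ∉ xs → sum (map f xs) ≡ 0
  sum-map-point-∉ xs z∉ = sum-map-≡0 xs (λ { x∈ → f-off λ { refl → z∉ x∈ } })

  sum-map-point-∈ : ∀ {xs} → Unique xs → z ∈ xs → sum (map f xs) ≡ f z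
  sum-map-point-∈ {z ∷ xs} (z∉ ∷ u) (here refl) =
    trans (cong (f z +_) (sum-map-point-∉ xs (λ z∈ → All.lookup z∉ z∈ refl))) (+-identityʳ _)
  sum-map-point-∈ {x ∷ xs} (x∉ ∷ u) (there z∈) =
    cong₂ _+_ (f-off (All.lookup x∉ z∈)) (sum-map-point-∈ u z∈)

-- Duplicate-free lists as finite sets.

unique∧set⇒↭ : ∀ {xs ys : List X} → Unique xs → Unique ys → (∀ z → z ∈ xs ⇔ z ∈ ys) → xs ↭ ys
unique∧set⇒↭ u v eq = ∼bag⇒↭ (unique∧set⇒bag u v (eq _))

lookup-injective : ∀ {xs : List X} → Unique xs → ∀ {i j} → lookup xs i ≡ lookup xs j → i ≡ j
lookup-injective {xs = _ ∷ _} (x∉ ∷ u) {fzero}  {fzero}  eq = refl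
lookup-injective {xs = _ ∷ _} (x∉ ∷ u) {fzero}  {fsuc j} eq = contradiction eq (All.lookup x∉ (∈-lookup j))
lookup-injective {xs = _ ∷ _} (x∉ ∷ u) {fsuc i} {fzero}  eq = contradiction (sym eq) (All.lookup x∉ (∈-lookup i))
lookup-injective {xs = _ ∷ _} (x∉ ∷ u) {fsuc i} {fsuc j} eq = cong fsuc (lookup-injective u eq)

∈⇒lookup : ∀ {xs : List X} {x} → x ∈ xs → ∃[ i ] x ≡ lookup xs i
∈⇒lookup (here eq) = fzero , eq
∈⇒lookup (there x∈) with i , eq ← ∈⇒lookup x∈ = fsuc i , eq

-- The length is a separate parameter `k` so that a list known to have `n` members can be indexed by
-- `Fin n`, as the rows of a square matrix must be.
enumerate : ∀ {k} (xs : List X) → length xs ≡ k → Unique xs →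
            Σ[ f ∈ (Fin k → X) ] ((∀ {i j} → f i ≡ f j → i ≡ j) × (∀ i → f i ∈ xs) ×
                                  (∀ {x} → x ∈ xs → ∃[ i ] x ≡ f i))
enumerate xs refl u = lookup xs , lookup-injective u , ∈-lookup , ∈⇒lookup

-- Hamming distance and complementation

hamming-refl : (x : Word n) → hamming x x ≡ 0
hamming-refl []      = refl
hamming-refl (b ∷ x) with b ≟ᵇ b
... | yes _  = hamming-refl x
... | no b≢b = contradiction refl b≢b

hamming-sym : (x y : Word n) → hamming x y ≡ hamming y x
hamming-sym []      []      = refl
hamming-sym (b ∷ x) (c ∷ y) with b ≟ᵇ c | c ≟ᵇ b
... | yes _  | yes _  = hamming-sym x y
... | no _   | no _   = cong suc (hamming-sym x y)
... | yes eq | no neq = contradiction (sym eq) neq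
... | no neq | yes eq = contradiction (sym eq) neq

hamming-≡0 : (x y : Word n) → hamming x y ≡ 0 → x ≡ y
hamming-≡0 []      []      eq = refl
hamming-≡0 (b ∷ x) (c ∷ y) eq with b ≟ᵇ c
... | yes refl = cong (b ∷_) (hamming-≡0 x y eq)

-- In each coordinate `x` differs from exactly one of `y` and `complement y`.
hamming-complement : (x y : Word n) → hamming x y + hamming x (complement y) ≡ n
hamming-complement []      []      = refl
hamming-complement (b ∷ x) (c ∷ y) with b ≟ᵇ c | b ≟ᵇ not c
... | yes _   | no _  = trans (+-suc _ _) (cong suc (hamming-complement x y))
... | no _    | yes _ = cong suc (hamming-complement x y)
... | yes b≡c | yes b≡c̄ = contradiction (trans (sym b≡c) b≡c̄) (not-¬ refl)
... | no b≢c  | no b≢c̄ = contradiction (¬-not b≢c) b≢c̄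

hamming≤n : (x y : Word n) → hamming x y ≤ n
hamming≤n x y = m+n≤o⇒m≤o _ (≤-reflexive (hamming-complement x y))

complement-involutive : (x : Word n) → complement (complement x) ≡ x
complement-involutive []      = refl
complement-involutive (b ∷ x) = cong₂ _∷_ (not-involutive b) (complement-involutive x)

complement-injective : {x y : Word n} → complement x ≡ complement y → x ≡ y
complement-injective {x = x} {y} eq =
  trans (sym (complement-involutive x)) (trans (cong complement eq) (complement-involutive y))

hamming-≡n : (x y : Word n) → hamming x y ≡ n → y ≡ complement x
hamming-≡n {n} x y eq = trans (sym (complement-involutive y)) (cong complement (sym (hamming-≡0 x (complement y)
  (+-cancelˡ-≡ n _ 0 (trans (cong (_+ hamming x (complement y)) (sym eq)) (trans (hamming-complement x y) (sym (+-identityʳ n))))))))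

hamming-self-complement : (x : Word n) → hamming x (complement x) ≡ n
hamming-self-complement x = trans (cong (_+ hamming x (complement x)) (sym (hamming-refl x))) (hamming-complement x x)

-- |⟨x, y⟩| for the ±1 vectors associated to x and y.
δ : Word n → Word n → ℕ
δ {n} x y = ∣ n - 2 * hamming x y ∣

δ-sym : (x y : Word n) → δ x y ≡ δ y x
δ-sym {n} x y = cong (λ h → ∣ n - 2 * h ∣) (hamming-sym x y)

hamming-complement-twice : (x y : Word n) → 2 * hamming x y + 2 * hamming x (complement y) ≡ n + n
hamming-complement-twice {n} x y = trans (sym (*-distribˡ-+ 2 (hamming x y) _))
  (trans (cong (2 *_) (hamming-complement x y)) (cong (λ k → n + k) (+-identityʳ n)))

-- The doubled distances to `y` and to its complement add up to `n + n`, so they lie symmetrically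
-- about `n`. The calculation shifts both arguments by `2 * h`, uses this sum, and cancels `n`.
δ-complementʳ : (x y : Word n) → δ x (complement y) ≡ δ x y
δ-complementʳ {n} x y = begin
  ∣ n - 2 * h′ ∣                   ≡⟨ ∣m+n-m+o∣≡∣n-o∣ (2 * h) n (2 * h′) ⟨
  ∣ 2 * h + n - 2 * h + 2 * h′ ∣   ≡⟨ cong₂ ∣_-_∣ (+-comm (2 * h) n) (hamming-complement-twice x y) ⟩
  ∣ n + 2 * h - n + n ∣            ≡⟨ ∣m+n-m+o∣≡∣n-o∣ n (2 * h) n ⟩
  ∣ 2 * h - n ∣                    ≡⟨ ∣-∣-comm (2 * h) n ⟩
  ∣ n - 2 * h ∣                    ∎
  where
  open ≡-Reasoning
  h = hamming x y
  h′ = hamming x (complement y)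

δ-complementˡ : (x y : Word n) → δ (complement x) y ≡ δ x y
δ-complementˡ x y = trans (δ-sym (complement x) y) (trans (δ-complementʳ y x) (δ-sym y x))

δ-refl : (x : Word n) → δ x x ≡ n
δ-refl {n} x = trans (cong (λ h → ∣ n - 2 * h ∣) (hamming-refl x)) (m≤n⇒∣n-m∣≡n∸m {n = n} z≤n)

∣n-t∣≡s⇒ : ∀ {n t s} → ∣ n - t ∣ ≡ s → t ≡ n ∸ s ⊎ t ≡ n + s
∣n-t∣≡s⇒ {n} {t} refl with ≤-total t n
... | inj₁ t≤n rewrite m≤n⇒∣n-m∣≡n∸m t≤n = inj₁ (sym (m∸[m∸n]≡n t≤n))
... | inj₂ n≤t rewrite m≤n⇒∣m-n∣≡n∸m n≤t = inj₂ (sym (m+[n∸m]≡n n≤t))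

∣n-[n∸s]∣≡s : ∀ {n s} → s ≤ n → ∣ n - (n ∸ s) ∣ ≡ s
∣n-[n∸s]∣≡s {n} {s} s≤n = trans (m≤n⇒∣n-m∣≡n∸m (m∸n≤m n s)) (m∸[m∸n]≡n s≤n)

[n∸s]+[n+s]≡n+n : ∀ {n s} → s ≤ n → (n ∸ s) + (n + s) ≡ n + n
[n∸s]+[n+s]≡n+n {n} {s} s≤n = begin
  (n ∸ s) + (n + s) ≡⟨ cong (λ k → n ∸ s + k) (+-comm n s) ⟩
  (n ∸ s) + (s + n) ≡⟨ +-assoc (n ∸ s) s n ⟨
  (n ∸ s) + s + n   ≡⟨ cong (λ k → k + n) (m∸n+n≡m s≤n) ⟩
  n + n             ∎
  where open ≡-Reasoning

-- The value `s` leaves two options for the doubled distance, `n ∸ s` and `n + s`; replacing `y` by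
-- its complement exchanges them, so both are realised. The bound `s ≤ n` keeps the subtraction from
-- truncating.
δ-attains : (x y : Word n) {s t : ℕ} → s ≤ n → δ x y ≡ s → t ≡ n ∸ s ⊎ t ≡ n + s →
            2 * hamming x y ≡ t ⊎ 2 * hamming x (complement y) ≡ t
δ-attains {n} x y {s} s≤n δ≡s t≡ with ∣n-t∣≡s⇒ {n} δ≡s | t≡
... | inj₁ h≡ | inj₁ refl = inj₁ h≡
... | inj₂ h≡ | inj₂ refl = inj₁ h≡
... | inj₁ h≡ | inj₂ refl = inj₂ (+-cancelˡ-≡ (n ∸ s) _ _
  (trans (cong (λ k → k + 2 * hamming x (complement y)) (sym h≡))
    (trans (hamming-complement-twice x y) (sym ([n∸s]+[n+s]≡n+n s≤n)))))
... | inj₂ h≡ | inj₁ refl = inj₂ (+-cancelˡ-≡ (n + s) _ _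
  (trans (cong (λ k → k + 2 * hamming x (complement y)) (sym h≡))
    (trans (hamming-complement-twice x y) (trans (sym ([n∸s]+[n+s]≡n+n s≤n)) (+-comm (n ∸ s) (n + s))))))

-- Distance distributions

indicator : ℕ → ℕ → ℕ
indicator i h = if h ≡ᵇ i then 1 else 0

indicator-≡ : ∀ i → indicator i i ≡ 1
indicator-≡ zero    = refl
indicator-≡ (suc i) = indicator-≡ i

indicator-≢ : ∀ {i h} → h ≢ i → indicator i h ≡ 0
indicator-≢ {zero}  {zero}  h≢i = contradiction refl h≢i
indicator-≢ {zero}  {suc h} h≢i = refl
indicator-≢ {suc i} {zero}  h≢i = refl
indicator-≢ {suc i} {suc h} h≢i = indicator-≢ (h≢i ∘ cong suc)

indicator-≢0⁻ : ∀ {i h} → indicator i h ≢ 0 → h ≡ i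
indicator-≢0⁻ {i} {h} ≢0 with h ≟ i
... | yes h≡i = h≡i
... | no h≢i  = contradiction (indicator-≢ h≢i) ≢0

count : ℕ → Word n → List (Word n) → ℕ
count i x Y = sum (map (λ y → indicator i (hamming x y)) Y)

-- Unfolds to `pairCount i C` when both lists are `C`, so facts about `cross` apply to `pairCount`
-- without conversion.
cross : ℕ → List (Word n) → List (Word n) → ℕ
cross i X Y = sum (map (λ x → count i x Y) X)

module _ {n i : ℕ} {X Y : List (Word n)} where

  cross-≢0⁻ : cross i X Y ≢ 0 → ∃[ x ] ∃[ y ] (x ∈ X × y ∈ Y × hamming x y ≡ i)
  cross-≢0⁻ ≢0 with x , x∈ , cx≢0 ← sum-map-≢0⁻ (λ x → count i x Y) X ≢0
                  with y , y∈ , ind≢0 ← sum-map-≢0⁻ (λ y → indicator i (hamming x y)) Y cx≢0 =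
    x , y , x∈ , y∈ , indicator-≢0⁻ ind≢0

  cross-≡0⁻ : cross i X Y ≡ 0 → ∀ {x y} → x ∈ X → y ∈ Y → hamming x y ≢ i
  cross-≡0⁻ ≡0 x∈ y∈ refl = case trans (sym (indicator-≡ i)) (sum-map-≡0⁻ Y (sum-map-≡0⁻ X ≡0 x∈) y∈) of λ ()

  cross-≡0⁺ : (∀ {x y} → x ∈ X → y ∈ Y → hamming x y ≢ i) → cross i X Y ≡ 0
  cross-≡0⁺ ≢i = sum-map-≡0 X λ x∈ → sum-map-≡0 Y λ y∈ → indicator-≢ (≢i x∈ y∈)

module _ (i : ℕ) {X Y : List (Word n)} where

  count-++ : ∀ x → count i x (X ++ Y) ≡ count i x X + count i x Y
  count-++ x = trans (cong sum (map-++ _ X Y)) (sum-++ (map _ X) _)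

  cross-++ˡ : ∀ Z → cross i (X ++ Y) Z ≡ cross i X Z + cross i Y Z
  cross-++ˡ Z = trans (cong sum (map-++ _ X Y)) (sum-++ (map _ X) _)

  cross-++ʳ : ∀ Z → cross i Z (X ++ Y) ≡ cross i Z X + cross i Z Y
  cross-++ʳ Z = trans (sum-map-cong Z (λ {x} _ → count-++ x))
    (sym (sum-map-+ (λ z → count i z X) (λ z → count i z Y) Z))

  pairCount-++ : pairCount i (X ++ Y) ≡
                 (pairCount i X + cross i X Y) + (cross i Y X + pairCount i Y)
  pairCount-++ = trans (cross-++ˡ (X ++ Y)) (cong₂ _+_ (cross-++ʳ X) (cross-++ʳ Y))

  pairCount-↭ : X ↭ Y → pairCount i X ≡ pairCount i Y
  pairCount-↭ σ = trans (sum-map-cong X (λ _ → sum-↭ (↭.map⁺ _ σ))) (sum-↭ (↭.map⁺ _ σ))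

count-self : {x : Word n} {Y : List (Word n)} → Unique Y → x ∈ Y → count 0 x Y ≡ 1
count-self {x = x} u x∈ = trans
  (sum-map-point-∈ (λ {y} y≢x → indicator-≢ (y≢x ∘ sym ∘ hamming-≡0 x y)) u x∈)
  (cong (indicator 0) (hamming-refl x))

module _ {n} {x : Word n} {Y : List (Word n)} where

  private
    off-complement : ∀ {y} → y ≢ complement x → indicator n (hamming x y) ≡ 0
    off-complement {y} y≢x̄ = indicator-≢ (y≢x̄ ∘ hamming-≡n x y)

  count-complement-∈ : Unique Y → complement x ∈ Y → count n x Y ≡ 1
  count-complement-∈ u x̄∈ = trans (sum-map-point-∈ off-complement u x̄∈)
    (trans (cong (indicator n) (hamming-self-complement x)) (indicator-≡ n))

  count-complement-∉ : complement x ∉ Y → count n x Y ≡ 0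
  count-complement-∉ = sum-map-point-∉ off-complement Y

-- Equality of unnormalised fractions is cross-multiplication, so the rational equation is moved
-- there and read off as one between natural numbers.
A≡⁻ : ∀ i (C : List (Word n)) k → A i C ≡ ℕ→ℚ k → pairCount i C ≡ k * length C
-- For the empty code both sides are 0, whatever `k` is.
A≡⁻ i []         k _  = sym (*-zeroʳ k)
A≡⁻ i C@(_ ∷ C′) k eq
  with *≡* e ← ℚᵘ.≃-trans (ℚᵘ.≃-sym (ℚ.toℚᵘ-fromℚᵘ (mkℚᵘ (pos (pairCount i C)) (length C′))))
              (ℚᵘ.≃-trans (ℚ.toℚᵘ-cong eq) (ℚ.toℚᵘ-fromℚᵘ (mkℚᵘ (pos k) 0))) =
  ℤ.+-injective (trans (sym (ℤ.*-identityʳ _)) (trans e (sym (ℤ.pos-* k _))))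

A≡⁺ : ∀ i (C : List (Word n)) k → 0 < length C → pairCount i C ≡ k * length C → A i C ≡ ℕ→ℚ k
A≡⁺ i C@(_ ∷ C′) k _ eq = ℚ.fromℚᵘ-cong {mkℚᵘ (pos (pairCount i C)) (length C′)} {mkℚᵘ (pos k) 0}
  (*≡* (trans (ℤ.*-identityʳ _) (trans (cong pos eq) (ℤ.pos-* k _))))

-- The empty code has all `A i` equal to `0ℚ` by convention, which differs from 1.
A≡1⇒length≢0 : ∀ i (C : List (Word n)) → A i C ≡ ℕ→ℚ 1 → length C ≢ 0
A≡1⇒length≢0 i [] ()

A≡0⁺ : ∀ i (C : List (Word n)) → pairCount i C ≡ 0 → A i C ≡ 0ℚ
A≡0⁺ i []      _  = refl
A≡0⁺ i (x ∷ C) eq = A≡⁺ i (x ∷ C) 0 (s≤s z≤n) eq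

A≡0⁻ : ∀ i (C : List (Word n)) → A i C ≡ 0ℚ → ∀ {x y} → x ∈ C → y ∈ C → hamming x y ≢ i
A≡0⁻ i C eq = cross-≡0⁻ (A≡⁻ i C 0 eq)

A≢0⁻ : ∀ i (C : List (Word n)) → A i C ≢ 0ℚ → ∃[ x ] ∃[ y ] (x ∈ C × y ∈ C × hamming x y ≡ i)
A≢0⁻ i C ≢0 = cross-≢0⁻ (≢0 ∘ A≡0⁺ i C)

-- Hadamard codes

-- The rows of a Hadamard matrix and their negatives, described without choosing an order or signs.
-- Both directions of the equivalence pass through this form.
record HadamardCode (C : List (Word n)) : Set where
  field
    distinct   : Unique C
    closed   : SelfComplementary C
    card     : length C ≡ 2 * n
    distance : ∀ {x y} → x ∈ C → y ∈ C → y ≡ x ⊎ y ≡ complement x ⊎ 2 * hamming x y ≡ n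

module _ {n m : ℕ} (0<n : 0 < n) (2m≡n : 2 * m ≡ n) where

  private
    0≢n : 0 ≢ n
    0≢n = <⇒≢ 0<n

    0≢m : 0 ≢ m
    0≢m refl = 0≢n 2m≡n

    m≢n : m ≢ n
    m≢n refl = 0≢m (sym (m+n≡0⇒m≡0 m (+-cancelˡ-≡ m _ _ (trans 2m≡n (sym (+-identityʳ m))))))

  module _ {C : List (Word n)}
    (distance : ∀ {x y} → x ∈ C → y ∈ C → y ≡ x ⊎ y ≡ complement x ⊎ 2 * hamming x y ≡ n) where

    private
      -- Since `n` is positive, 0, `m` and `n` are pairwise distinct, so exactly one of the three
      -- indicators fires.
      one : ∀ {x y} → x ∈ C → y ∈ C → let h = hamming x y in
            indicator 0 h + indicator m h + indicator n h ≡ 1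
      one {x} {y} x∈ y∈ with distance x∈ y∈
      ... | inj₁ refl rewrite hamming-refl x =
        cong₂ _+_ (cong₂ _+_ (indicator-≡ 0) (indicator-≢ 0≢m)) (indicator-≢ 0≢n)
      ... | inj₂ (inj₁ refl) rewrite hamming-self-complement x =
        cong₂ _+_ (cong₂ _+_ (indicator-≢ (0≢n ∘ sym)) (indicator-≢ (m≢n ∘ sym))) (indicator-≡ n)
      ... | inj₂ (inj₂ 2h≡n) rewrite *-cancelˡ-≡ (hamming x y) m 2 (trans 2h≡n (sym 2m≡n)) =
        cong₂ _+_ (cong₂ _+_ (indicator-≢ (0≢m ∘ sym)) (indicator-≡ m)) (indicator-≢ m≢n)

    count-total : ∀ {x} → x ∈ C → count 0 x C + count m x C + count n x C ≡ length C
    count-total {x} x∈ = begin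
      count 0 x C + count m x C + count n x C   ≡⟨ cong (_+ count n x C) (sum-map-+ _ _ C) ⟩
      sum (map (λ y → indicator 0 (hamming x y) + indicator m (hamming x y)) C) + count n x C
                                                ≡⟨ sum-map-+ _ _ C ⟩
      sum (map (λ y → indicator 0 (hamming x y) + indicator m (hamming x y) + indicator n (hamming x y)) C)
                                                ≡⟨ sum-map-const C (one x∈) ⟩
      length C * 1                              ≡⟨ *-identityʳ _ ⟩
      length C                                  ∎
      where open ≡-Reasoning

    pairCount-total : pairCount 0 C + pairCount m C + pairCount n C ≡ length C * length C
    pairCount-total = begin
      pairCount 0 C + pairCount m C + pairCount n C  ≡⟨ cong (_+ pairCount n C) (sum-map-+ _ _ C) ⟩
      sum (map (λ x → count 0 x C + count m x C) C) + pairCount n C ≡⟨ sum-map-+ _ _ C ⟩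
      sum (map (λ x → count 0 x C + count m x C + count n x C) C)   ≡⟨ sum-map-const C count-total ⟩
      length C * length C                           ∎
      where open ≡-Reasoning

-- Positivity of `n` gives `2 ≤ 2 * n`, so the truncated subtraction is a true one.
1+[2n∸2]+1 : ∀ {n} → 0 < n → 1 + (2 * n ∸ 2) + 1 ≡ 2 * n
1+[2n∸2]+1 {suc n} _ rewrite +-suc n (n + 0) = cong suc (+-comm _ 1)

module _ {n : ℕ} (0<n : 0 < n) {C : List (Word n)} where

  HalfDistribution⇒HadamardCode : ∀ {m} → 2 * m ≡ n → Unique C → HalfDistribution C → HadamardCode C
  HalfDistribution⇒HadamardCode {m} 2m≡n distinct half = record
    { distinct = distinct ; closed = closed ; card = card ; distance = distance }
    where
    distance : ∀ {x y} → x ∈ C → y ∈ C → y ≡ x ⊎ y ≡ complement x ⊎ 2 * hamming x y ≡ n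
    distance {x} {y} x∈ y∈ with hamming x y ≟ 0 | hamming x y ≟ n | 2 * hamming x y ≟ n
    ... | yes h≡0 | _ | _ = inj₁ (sym (hamming-≡0 x y h≡0))
    ... | _ | yes h≡n | _ = inj₂ (inj₁ (hamming-≡n x y h≡n))
    ... | _ | _ | yes 2h≡n = inj₂ (inj₂ 2h≡n)
    ... | no h≢0 | no h≢n | no 2h≢n =
      -- Any other distance has `A j C ≡ 0ℚ`, yet `x` and `y` themselves form a pair at that
      -- distance.
      contradiction refl (A≡0⁻ _ C (proj₂ (proj₂ (proj₂ (half _))) h≢0 2h≢n h≢n) x∈ y∈)

    L = length C

    L≢0 : L ≢ 0
    L≢0 = A≡1⇒length≢0 0 C (proj₁ (half 0) refl)

    pc0 : pairCount 0 C ≡ 1 * L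
    pc0 = A≡⁻ 0 C 1 (proj₁ (half 0) refl)

    pcm : pairCount m C ≡ (2 * n ∸ 2) * L
    pcm = A≡⁻ m C (2 * n ∸ 2) (proj₁ (proj₂ (half m)) 2m≡n)

    pcn : pairCount n C ≡ 1 * L
    pcn = A≡⁻ n C 1 (proj₁ (proj₂ (proj₂ (half n))) refl)

    -- All `L * L` ordered pairs are at distance 0, `m` or `n`, and the distribution counts them as
    -- `(1 + (2 * n ∸ 2) + 1) * L`. Cancelling the nonzero `L` leaves the size.
    card : L ≡ 2 * n
    card = sym (*-cancelʳ-≡ (2 * n) L L {{≢-nonZero L≢0}} (begin
      2 * n * L                                      ≡⟨ cong (_* L) (1+[2n∸2]+1 0<n) ⟨
      (1 + (2 * n ∸ 2) + 1) * L                      ≡⟨ *-distribʳ-+ L (1 + (2 * n ∸ 2)) 1 ⟩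
      (1 + (2 * n ∸ 2)) * L + 1 * L                  ≡⟨ cong (_+ 1 * L) (*-distribʳ-+ L 1 (2 * n ∸ 2)) ⟩
      1 * L + (2 * n ∸ 2) * L + 1 * L                ≡⟨ cong₂ _+_ (cong₂ _+_ pc0 pcm) pcn ⟨
      pairCount 0 C + pairCount m C + pairCount n C  ≡⟨ pairCount-total 0<n 2m≡n distance ⟩
      L * L                                          ∎))
      where open ≡-Reasoning

    open import Data.List.Membership.DecPropositional (Vec.≡-dec _≟ᵇ_) using (_∈?_)

    count≤1 : ∀ x → count n x C ≤ 1
    count≤1 x with complement x ∈? C
    ... | yes x̄∈ = ≤-reflexive (count-complement-∈ distinct x̄∈)
    ... | no x̄∉ = ≤-trans (≤-reflexive (count-complement-∉ x̄∉)) z≤n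

    -- There are exactly `L` ordered pairs at distance `n`, while each of the `L` words has at most
    -- one partner at that distance; hence none can lack its complement.
    closed : SelfComplementary C
    closed x x∈ with complement x ∈? C
    ... | yes x̄∈ = x̄∈
    ... | no x̄∉ = contradiction (count-complement-∉ x̄∉)
      (sum-map≡length⁻ C (λ {y} _ → count≤1 y) (trans pcn (*-identityˡ L)) x∈)

  module _ (hadamard : HadamardCode C) where

    open HadamardCode hadamard

    private
      0<L : 0 < length C
      0<L = subst (0 <_) (sym card) (<-≤-trans 0<n (m≤m+n n _))

      1*L : ∀ i → (∀ {x} → x ∈ C → count i x C ≡ 1) → A i C ≡ ℕ→ℚ 1
      1*L i count≡1 = A≡⁺ i C 1 0<L (trans (sum-map-const C count≡1) (*-comm (length C) 1))

    -- From a fixed word, the `2 * n` words of `C` consist of the word itself, its complement, and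
    -- the rest at distance `m`.
    pairCount-half : ∀ {m} → 2 * m ≡ n → pairCount m C ≡ (2 * n ∸ 2) * length C
    pairCount-half {m} 2m≡n = trans (sum-map-const C count-half) (*-comm (length C) _)
      where
      open ≡-Reasoning
      count-half : ∀ {x} → x ∈ C → count m x C ≡ 2 * n ∸ 2
      count-half {x} x∈ = +-cancelˡ-≡ 1 _ _ (+-cancelʳ-≡ 1 _ _ (begin
        1 + count m x C + 1
          ≡⟨ cong₂ (λ k l → k + count m x C + l) (count-self distinct x∈)
               (count-complement-∈ distinct (closed x x∈)) ⟨
        count 0 x C + count m x C + count n x C  ≡⟨ count-total 0<n 2m≡n distance x∈ ⟩
        length C                                 ≡⟨ card ⟩
        2 * n                                    ≡⟨ 1+[2n∸2]+1 0<n ⟨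
        1 + (2 * n ∸ 2) + 1                      ∎))

    HadamardCode⇒HalfDistribution : HalfDistribution C
    HadamardCode⇒HalfDistribution j =
        (λ { refl → 1*L 0 (count-self distinct) })
      , (λ 2j≡n → A≡⁺ j C (2 * n ∸ 2) 0<L (pairCount-half 2j≡n))
      , (λ { refl → 1*L n (λ x∈ → count-complement-∈ distinct (closed _ x∈)) })
      , λ j≢0 2j≢n j≢n → A≡0⁺ j C (cross-≡0⁺ λ {x} x∈ y∈ → case distance x∈ y∈ of λ
          { (inj₁ refl) h≡j → j≢0 (trans (sym h≡j) (hamming-refl x))
          ; (inj₂ (inj₁ refl)) h≡j → j≢n (trans (sym h≡j) (hamming-self-complement x))
          ; (inj₂ (inj₂ 2h≡n)) refl → 2j≢n 2h≡n })

2h≡n⇒δ≡0 : (x y : Word n) → 2 * hamming x y ≡ n → δ x y ≡ 0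
2h≡n⇒δ≡0 x y eq = m≡n⇒∣m-n∣≡0 (sym eq)

δ≡0⇒2h≡n : (x y : Word n) → δ x y ≡ 0 → 2 * hamming x y ≡ n
δ≡0⇒2h≡n x y eq = sym (∣m-n∣≡0⇒m≡n eq)

-- Words up to complementation, and the signed rows of an orthogonal family.

_≈±_ : Word n → Word n → Set
x ≈± u = x ≡ u ⊎ x ≡ complement u

≈±-complement : (x u : Word n) → x ≈± u → complement x ≈± u
≈±-complement x u (inj₁ refl) = inj₂ refl
≈±-complement x u (inj₂ refl) = inj₁ (complement-involutive u)

≈±-common : {x y u : Word n} → x ≈± u → y ≈± u → y ≈± x
≈±-common (inj₁ refl) y≈u         = y≈u
≈±-common (inj₂ refl) (inj₁ refl) = inj₂ (sym (complement-involutive _))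
≈±-common (inj₂ refl) (inj₂ refl) = inj₁ refl

δ-cong-± : {x y u v : Word n} → x ≈± u → y ≈± v → δ x y ≡ δ u v
δ-cong-± {u = u} {v} (inj₁ refl) (inj₁ refl) = refl
δ-cong-± {u = u} {v} (inj₁ refl) (inj₂ refl) = δ-complementʳ u v
δ-cong-± {u = u} {v} (inj₂ refl) (inj₁ refl) = δ-complementˡ u v
δ-cong-± {u = u} {v} (inj₂ refl) (inj₂ refl) =
  trans (δ-complementˡ u (complement v)) (δ-complementʳ u v)

OrthogonalFamily : (Fin n → Word n) → Set
OrthogonalFamily f = ∀ {i j} → i ≢ j → δ (f i) (f j) ≡ 0

signedRows : (Fin n → Word n) → List (Word n)
signedRows f = tabulate f ++ map complement (tabulate f)

module _ {f : Fin n → Word n} where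

  ∈-signedRows⁺ : ∀ {x} i → x ≈± f i → x ∈ signedRows f
  ∈-signedRows⁺ i (inj₁ refl) = ∈-++⁺ˡ (∈-tabulate⁺ i)
  ∈-signedRows⁺ i (inj₂ refl) = ∈-++⁺ʳ (tabulate f) (∈-map⁺ complement (∈-tabulate⁺ i))

  ∈-signedRows⁻ : ∀ {x} → x ∈ signedRows f → ∃[ i ] x ≈± f i
  ∈-signedRows⁻ x∈ with ∈-++⁻ (tabulate f) x∈
  ... | inj₁ x∈ˡ with i , refl ← ∈-tabulate⁻ x∈ˡ = i , inj₁ refl
  ... | inj₂ x∈ʳ with _ , x̄∈ , refl ← ∈-map⁻ complement x∈ʳ
                 with i , refl ← ∈-tabulate⁻ x̄∈ = i , inj₂ refl

module _ {n : ℕ} (0<n : 0 < n) {f : Fin n → Word n} (orthogonal : OrthogonalFamily f) where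

  private
    0≢n : 0 ≢ n
    0≢n = <⇒≢ 0<n

    -- Rows equal up to sign have `δ` equal to `n`, whereas distinct indices would force 0.
    same-index : ∀ {i j} → f i ≈± f j → i ≡ j
    same-index {i} {j} fi≈fj with i Fin.≟ j
    ... | yes i≡j = i≡j
    ... | no i≢j  = contradiction
      (trans (sym (orthogonal i≢j)) (trans (δ-cong-± fi≈fj (inj₁ refl)) (δ-refl (f j)))) 0≢n

    x≢complement : (x : Word n) → x ≢ complement x
    x≢complement x eq = 0≢n (trans (sym (hamming-refl x))
      (trans (cong (hamming x) eq) (hamming-self-complement x)))

  signedRows-HadamardCode : HadamardCode (signedRows f)
  signedRows-HadamardCode = record
    { distinct = Unique.++⁺ unique-rows (Unique.map⁺ complement-injective unique-rows) disjoint
    ; closed   = λ x x∈ → let i , x≈ = ∈-signedRows⁻ x∈ in ∈-signedRows⁺ i (≈±-complement x (f i) x≈)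
    ; card     = trans (length-++ (tabulate f)) (cong₂ _+_ (length-tabulate f)
                   (trans (length-map complement (tabulate f))
                     (trans (length-tabulate f) (sym (+-identityʳ n)))))
    ; distance = distance
    }
    where
    unique-rows : Unique (tabulate f)
    unique-rows = Unique.tabulate⁺ (same-index ∘ inj₁)

    disjoint : ∀ {x} → ¬ (x ∈ tabulate f × x ∈ map complement (tabulate f))
    disjoint (x∈ , x∈′) with i , refl ← ∈-tabulate⁻ x∈
                        with _ , y∈ , fi≡ȳ ← ∈-map⁻ complement x∈′
                        with j , refl ← ∈-tabulate⁻ y∈
                        -- A row that is also a negated row must be the negative of itself, which is
                        -- impossible for words of positive length.
                        with refl ← same-index {i} {j} (inj₂ fi≡ȳ) = x≢complement (f i) fi≡ȳ

    distance : ∀ {x y} → x ∈ signedRows f → y ∈ signedRows f →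
               y ≡ x ⊎ y ≡ complement x ⊎ 2 * hamming x y ≡ n
    distance {x} {y} x∈ y∈ with i , x≈ ← ∈-signedRows⁻ x∈ | j , y≈ ← ∈-signedRows⁻ y∈ with i Fin.≟ j
    ... | no i≢j = inj₂ (inj₂ (δ≡0⇒2h≡n x y (trans (δ-cong-± x≈ y≈) (orthogonal i≢j))))
    ... | yes refl with ≈±-common x≈ y≈
    ...   | inj₁ y≡x = inj₁ y≡x
    ...   | inj₂ y≡x̄ = inj₂ (inj₁ y≡x̄)

-- Recovering an orthogonal family from a Hadamard code.

leading : Word n → Bool
leading []      = false
leading (b ∷ _) = b

leading-complement : 0 < n → (x : Word n) → leading (complement x) ≡ not (leading x)
leading-complement _ (b ∷ x) = refl

-- One word from each complementary pair: the one with leading bit false.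
module _ {n : ℕ} (0<n : 0 < n) {C : List (Word n)} (hadamard : HadamardCode C) where

  open HadamardCode hadamard

  private
    leads? : (x : Word n) → Dec (leading x ≡ false)
    leads? x = leading x ≟ᵇ false

    R : List (Word n)
    R = filter leads? C

    unique-R : Unique R
    unique-R = Unique.filter⁺ leads? distinct

    leading-R : ∀ {x} → x ∈ R → leading x ≡ false
    leading-R x∈ = proj₂ (∈-filter⁻ leads? {xs = C} x∈)

    complement∉R : ∀ {x} → leading x ≡ false → complement x ∉ R
    complement∉R {x} lx x̄∈ = case trans (sym (leading-R x̄∈)) (trans (leading-complement 0<n x) (cong not lx)) of λ ()

    disjoint : ∀ {x} → ¬ (x ∈ R × x ∈ map complement R)
    disjoint (x∈ , x∈′) with y , y∈ , refl ← ∈-map⁻ complement x∈′ = complement∉R (leading-R y∈) x∈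

    split : ∀ {x} → x ∈ C → x ∈ R ⊎ complement x ∈ R
    split {x} x∈ with leading x in eq
    ... | false = inj₁ (∈-filter⁺ leads? x∈ eq)
    ... | true  = inj₂ (∈-filter⁺ leads? (closed x x∈) (trans (leading-complement 0<n x) (cong not eq)))

    -- Both lists are duplicate-free, so it suffices to compare their members: each word of `C`, or
    -- else its complement, has leading bit `false`.
    C↭R++R̄ : C ↭ R ++ map complement R
    C↭R++R̄ = unique∧set⇒↭ distinct
      (Unique.++⁺ unique-R (Unique.map⁺ complement-injective unique-R) disjoint)
      λ x → mk⇔
        (λ x∈ → [ ∈-++⁺ˡ , (λ x̄∈ → ∈-++⁺ʳ R
          (subst (_∈ map complement R) (complement-involutive x) (∈-map⁺ complement x̄∈))) ]′ (split x∈))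
        (λ x∈ → [ proj₁ ∘ ∈-filter⁻ leads? , (λ x∈R̄ → let y , y∈ , x≡ȳ = ∈-map⁻ complement x∈R̄ in
          subst (_∈ C) (sym x≡ȳ) (closed y (proj₁ (∈-filter⁻ leads? y∈)))) ]′ (∈-++⁻ R x∈))

    length-R : length R ≡ n
    length-R = *-cancelˡ-≡ (length R) n 2 (begin
      2 * length R                          ≡⟨ cong (λ k → length R + k) (+-identityʳ (length R)) ⟩
      length R + length R                   ≡⟨ cong (λ k → length R + k) (length-map complement R) ⟨
      length R + length (map complement R)  ≡⟨ length-++ R ⟨
      length (R ++ map complement R)        ≡⟨ ↭.↭-length C↭R++R̄ ⟨
      length C                              ≡⟨ card ⟩
      2 * n                                 ∎)
      where open ≡-Reasoning

  representatives : Σ[ f ∈ (Fin n → Word n) ]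
    (OrthogonalFamily f × (∀ i → f i ∈ C) × (∀ {x} → x ∈ C → ∃[ i ] x ≈± f i))
  representatives with f , injective , f∈R , surjective ← enumerate R length-R unique-R =
    f , orthogonal , f∈C , λ x∈ → [ (λ x∈R → let i , x≡ = surjective x∈R in i , inj₁ x≡)
                                  , (λ x̄∈R → let i , x̄≡ = surjective x̄∈R in
                                      i , inj₂ (trans (sym (complement-involutive _)) (cong complement x̄≡))) ]′
                                  (split x∈)
    where
    f∈C : ∀ i → f i ∈ C
    f∈C i = proj₁ (∈-filter⁻ leads? (f∈R i))

    -- Two members of `R` cannot be complementary, because both have leading bit `false`; distinct
    -- ones are therefore at distance `n/2`.
    orthogonal : OrthogonalFamily f
    orthogonal {i} {j} i≢j with distance (f∈C i) (f∈C j)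
    ... | inj₁ fj≡fi          = contradiction (injective (sym fj≡fi)) i≢j
    ... | inj₂ (inj₁ fj≡f̄i)   = contradiction (subst (_∈ R) fj≡f̄i (f∈R j)) (complement∉R (leading-R (f∈R i)))
    ... | inj₂ (inj₂ 2h≡n)    = 2h≡n⇒δ≡0 (f i) (f j) 2h≡n

-- Hadamard matrices

sign : Bool → ℤ
sign false = pos 1
sign true  = -[1+ 0 ]

Σℤ-cong : ∀ n {f g : Fin n → ℤ} → (∀ k → f k ≡ g k) → Σℤ n f ≡ Σℤ n g
Σℤ-cong zero    f≗g = refl
Σℤ-cong (suc n) f≗g = cong₂ _+ℤ_ (f≗g fzero) (Σℤ-cong n (f≗g ∘ fsuc))

-- Agreeing coordinates contribute 1 and differing ones -1, giving `(n - h) - h`; the integer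
-- difference `⊖` avoids truncation.
inner-product : (x y : Word n) →
  Σℤ n (λ k → sign (Vec.lookup x k) *ℤ sign (Vec.lookup y k)) ≡ n ⊖ 2 * hamming x y
inner-product []      []      = refl
inner-product {suc n} (b ∷ x) (c ∷ y) with b ≟ᵇ c
... | yes refl = trans (cong₂ _+ℤ_ (sign² b) (inner-product x y))
                   (ℤ.distribʳ-⊖-+-pos 1 n (2 * hamming x y))
  where
  sign² : ∀ b → sign b *ℤ sign b ≡ pos 1
  sign² false = refl
  sign² true  = refl
... | no b≢c = begin
  sign b *ℤ sign c +ℤ _                ≡⟨ cong₂ _+ℤ_ (sign-≢ b c b≢c) (inner-product x y) ⟩
  -[1+ 0 ] +ℤ (n ⊖ 2 * h)              ≡⟨ ℤ.distribʳ-⊖-+-neg 0 n (2 * h) ⟩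
  -- Adding a successor on both sides turns the drop by one into growth of the length by 1 and of
  -- the doubled distance by 2.
  n ⊖ suc (2 * h)                      ≡⟨ ℤ.[1+m]⊖[1+n]≡m⊖n n (suc (2 * h)) ⟨
  suc n ⊖ suc (suc (2 * h))            ≡⟨ cong (suc n ⊖_) (*-suc 2 h) ⟨
  suc n ⊖ 2 * suc h                    ∎
  where
  open ≡-Reasoning
  h = hamming x y
  sign-≢ : ∀ b c → b ≢ c → sign b *ℤ sign c ≡ -[1+ 0 ]
  sign-≢ false false b≢c = contradiction refl b≢c
  sign-≢ false true  b≢c = refl
  sign-≢ true  false b≢c = refl
  sign-≢ true  true  b≢c = contradiction refl b≢c

∣m⊖n∣≡∣m-n∣ : ∀ m n → ∣ m ⊖ n ∣ ≡ ∣ m - n ∣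
∣m⊖n∣≡∣m-n∣ zero    zero    = refl
∣m⊖n∣≡∣m-n∣ zero    (suc n) = refl
∣m⊖n∣≡∣m-n∣ (suc m) zero    = refl
∣m⊖n∣≡∣m-n∣ (suc m) (suc n) = trans (cong ∣_∣ (ℤ.[1+m]⊖[1+n]≡m⊖n m n)) (∣m⊖n∣≡∣m-n∣ m n)

signMatrix : (Fin n → Word n) → Matrix n
signMatrix f i k = sign (Vec.lookup (f i) k)

∣signMatrix∣ : ∀ (f g : Fin n → Word n) i j → ∣ (signMatrix f ·ᵀ signMatrix g) i j ∣ ≡ δ (f i) (g j)
∣signMatrix∣ {n} f g i j = trans (cong ∣_∣ (inner-product (f i) (g j))) (∣m⊖n∣≡∣m-n∣ n _)

signMatrix-IsHadamard : {f : Fin n → Word n} → OrthogonalFamily f → IsHadamard n (signMatrix f)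
signMatrix-IsHadamard {n} {f} orthogonal = record
  { entries = λ i k → sign-±1 (Vec.lookup (f i) k) ; orthog = orthog }
  where
  sign-±1 : ∀ b → sign b ≡ pos 1 ⊎ sign b ≡ -[1+ 0 ]
  sign-±1 false = inj₁ refl
  sign-±1 true  = inj₂ refl

  orthog : ∀ i j → (signMatrix f ·ᵀ signMatrix f) i j ≡ scaledId n i j
  orthog i j with i Fin.≟ j
  ... | yes refl = trans (inner-product (f i) (f i)) (cong (λ h → n ⊖ 2 * h) (hamming-refl (f i)))
  ... | no i≢j   = ℤ.∣i∣≡0⇒i≡0 (trans (∣signMatrix∣ f f i j) (orthogonal i≢j))

negative : ℤ → Bool
negative (pos _)  = false
negative -[1+ _ ] = true

signRows : Matrix n → Fin n → Word n
signRows H i = Vec.tabulate (λ k → negative (H i k))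

module _ {H : Matrix n} (hadamard : IsHadamard n H) where

  open IsHadamard hadamard

  signMatrix-signRows : ∀ i k → signMatrix (signRows H) i k ≡ H i k
  signMatrix-signRows i k = trans (cong sign (Vec.lookup∘tabulate _ k)) (sign-negative (H i k) (entries i k))
    where
    sign-negative : ∀ z → z ≡ pos 1 ⊎ z ≡ -[1+ 0 ] → sign (negative z) ≡ z
    sign-negative _ (inj₁ refl) = refl
    sign-negative _ (inj₂ refl) = refl

-- The sign bits of a matrix with entries 1 and -1 recover it entry by entry, so the two inner
-- products agree summand by summand.
δ-signRows : {H K : Matrix n} → IsHadamard n H → IsHadamard n K →
             ∀ i j → δ (signRows H i) (signRows K j) ≡ ∣ (H ·ᵀ K) i j ∣
δ-signRows {n} {H} {K} hH hK i j = trans (sym (∣signMatrix∣ (signRows H) (signRows K) i j))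
  (cong ∣_∣ (Σℤ-cong n λ k → cong₂ _*ℤ_ (signMatrix-signRows hH i k) (signMatrix-signRows hK j k)))

signRows-orthogonal : {H : Matrix n} → IsHadamard n H → OrthogonalFamily (signRows H)
signRows-orthogonal {n} hH {i} {j} i≢j =
  trans (δ-signRows hH hH i j) (cong ∣_∣ (trans (IsHadamard.orthog hH i j) scaledId-≢))
  where
  scaledId-≢ : scaledId n i j ≡ pos 0
  scaledId-≢ with i Fin.≟ j
  ... | yes i≡j = contradiction i≡j i≢j
  ... | no _    = refl

-- Unions of two Hadamard codes

-- The condition on `σ` in terms of codes: `δ` ignores complements, so it does not depend on which
-- rows represent `X` and `Y`.
record CrossSpectrum (X Y : List (Word n)) (a b : ℕ) : Set where
  field
    values    : ∀ {x y} → x ∈ X → y ∈ Y → δ x y ≡ 2 * a ⊎ δ x y ≡ 2 * b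
    attained₁ : ∃[ x ] ∃[ y ] (x ∈ X × y ∈ Y × δ x y ≡ 2 * a)
    attained₂ : ∃[ x ] ∃[ y ] (x ∈ X × y ∈ Y × δ x y ≡ 2 * b)

-- For odd `a`, `2 * a` is 2 modulo 4, and the sign is immaterial because 2 and -2 agree modulo 4.
4∣z-2 : ∀ z {a} → Odd a → ∣ z ∣ ≡ 2 * a → pos 4 ∣ℤ (z -ℤ pos 2)
4∣z-2 z {a} (k , refl) = by-sign z ∘ (λ eq → trans eq 2a≡2+k*4)
  where
  2a≡2+k*4 : 2 * suc (2 * k) ≡ 2 + k * 4
  2a≡2+k*4 = solve 1 (λ k → con 2 :* (con 1 :+ con 2 :* k) := con 2 :+ k :* con 4) refl k
    where open +-*-Solver

  by-sign : ∀ z → ∣ z ∣ ≡ 2 + k * 4 → pos 4 ∣ℤ (z -ℤ pos 2)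
  by-sign (pos _)  refl = divides k refl
  -- Here `z - 2` is `-(4 + 4k)`, which accounts for the quotient `suc k`.
  by-sign -[1+ _ ] refl = divides (suc k) (cong (λ u → 3 + u) (+-comm (k * 4) 1))

module _ {n a b : ℕ} (0<n : 0 < n) (0<a : 0 < a) (a<b : a < b) (2b<n : 2 * b < n) where

  private
    0<2a : 0 < 2 * a
    0<2a = *-monoʳ-< 2 0<a

    2a<2b : 2 * a < 2 * b
    2a<2b = *-monoʳ-< 2 a<b

    2a<n : 2 * a < n
    2a<n = <-trans 2a<2b 2b<n

    δ-cross-≢n : ∀ {s} → s ≡ 2 * a ⊎ s ≡ 2 * b → s ≢ n
    δ-cross-≢n (inj₁ refl) = <⇒≢ 2a<n
    δ-cross-≢n (inj₂ refl) = <⇒≢ 2b<n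

    δ-cross-≢0 : ∀ {s} → s ≡ 2 * a ⊎ s ≡ 2 * b → s ≢ 0
    δ-cross-≢0 (inj₁ refl) = <⇒≢ 0<2a ∘ sym
    δ-cross-≢0 (inj₂ refl) = <⇒≢ (<-trans 0<2a 2a<2b) ∘ sym

  -- From a cross spectrum to a code.

  module _ {X Y : List (Word n)} (hX : HadamardCode X) (hY : HadamardCode Y)
           (spectrum : CrossSpectrum X Y a b) where

    private
      module HX = HadamardCode hX
      module HY = HadamardCode hY
    open CrossSpectrum spectrum

    -- A common word would have `δ z z` equal to `n`, but values across the codes are `2 * a` or
    -- `2 * b`, both below `n`.
    disjoint-codes : ∀ {z} → ¬ (z ∈ X × z ∈ Y)
    disjoint-codes {z} (z∈X , z∈Y) = δ-cross-≢n (values z∈X z∈Y) (δ-refl z)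

    -- A pair with `δ` equal to `2 * b` has doubled distance `n ∸ 2 * b` or `n + 2 * b`, so `n` is
    -- twice `hamming x y` plus or minus `b`.
    n-even : ∃[ m ] 2 * m ≡ n
    n-even with x , y , _ , _ , δ≡ ← attained₂ with ∣n-t∣≡s⇒ {n} {2 * hamming x y} δ≡
    ... | inj₁ 2h≡ = hamming x y + b , trans (*-distribˡ-+ 2 (hamming x y) b)
                       (trans (cong (λ k → k + 2 * b) 2h≡) (m∸n+n≡m (<⇒≤ 2b<n)))
    ... | inj₂ 2h≡ = hamming x y ∸ b , trans (*-distribˡ-∸ 2 (hamming x y) b)
                       (trans (cong (λ k → k ∸ 2 * b) 2h≡) (m+n∸n≡m n (2 * b)))

    union : Code n (4 * n)
    union = mkCode (X ++ Y) (Unique.++⁺ HX.distinct HY.distinct disjoint-codes)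
      (trans (length-++ X) (trans (cong₂ _+_ HX.card HY.card)
        (solve 1 (λ n → con 2 :* n :+ con 2 :* n := con 4 :* n) refl n)))
      where open +-*-Solver

    union-closed : SelfComplementary (words union)
    union-closed x x∈ = [ ∈-++⁺ˡ ∘ HX.closed x , ∈-++⁺ʳ X ∘ HY.closed x ]′ (∈-++⁻ X x∈)

    0<length-union : 0 < length (words union)
    0<length-union = subst (0 <_) (sym (size union)) (*-monoʳ-< 4 0<n)

    -- A pair across the codes at distance `m` would have `δ` equal to 0, so only pairs inside `X`
    -- or inside `Y` are counted.
    union-half : ∀ m → 2 * m ≡ n → A m (words union) ≡ ℕ→ℚ (2 * n ∸ 2)
    union-half m 2m≡n = A≡⁺ m (words union) (2 * n ∸ 2) 0<length-union (begin
      pairCount m (X ++ Y)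
        ≡⟨ pairCount-++ m {X} {Y} ⟩
      (pairCount m X + cross m X Y) + (cross m Y X + pairCount m Y)
        ≡⟨ cong₂ _+_ (cong₂ _+_ (pairCount-half 0<n hX 2m≡n) (cross-≡0⁺ (λ {x} {y} → h≢m x y)))
                     (cong₂ _+_ (cross-≡0⁺ (λ {y} {x} y∈ x∈ → h≢m x y x∈ y∈ ∘ trans (hamming-sym x y)))
                                (pairCount-half 0<n hY 2m≡n)) ⟩
      ((2 * n ∸ 2) * length X + 0) + (0 + (2 * n ∸ 2) * length Y)
        ≡⟨ cong (λ k → k + (2 * n ∸ 2) * length Y) (+-identityʳ _) ⟩
      (2 * n ∸ 2) * length X + (2 * n ∸ 2) * length Y
        ≡⟨ *-distribˡ-+ (2 * n ∸ 2) (length X) (length Y) ⟨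
      (2 * n ∸ 2) * (length X + length Y)
        ≡⟨ cong ((2 * n ∸ 2) *_) (length-++ X) ⟨
      (2 * n ∸ 2) * length (X ++ Y) ∎)
      where
      open ≡-Reasoning
      h≢m : ∀ x y → x ∈ X → y ∈ Y → hamming x y ≢ m
      h≢m x y x∈ y∈ refl = δ-cross-≢0 (values x∈ y∈) (2h≡n⇒δ≡0 x y 2m≡n)

    private
      InSet : ℕ → Set
      InSet = InDoubledSet n a b

      Attained : ℕ → Set
      Attained t = ∃[ x ] ∃[ y ] (x ∈ words union × y ∈ words union × 2 * hamming x y ≡ t)

      within : ∀ {x y : Word n} → y ≡ x ⊎ y ≡ complement x ⊎ 2 * hamming x y ≡ n → InSet (2 * hamming x y)
      within {x} (inj₁ refl)        = inj₁ (cong (2 *_) (hamming-refl x))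
      within {x} (inj₂ (inj₁ refl)) =
        inj₂ (inj₂ (inj₂ (inj₂ (inj₂ (inj₂ (cong (2 *_) (hamming-self-complement x)))))))
      within     (inj₂ (inj₂ 2h≡n)) = inj₂ (inj₂ (inj₂ (inj₂ (inj₂ (inj₁ 2h≡n)))))

      between : ∀ {x y} → x ∈ X → y ∈ Y → InSet (2 * hamming x y)
      between {x} {y} x∈ y∈ with values x∈ y∈
      ... | inj₁ δ≡2a = [ inj₂ ∘ inj₁ , inj₂ ∘ inj₂ ∘ inj₁ ]′ (∣n-t∣≡s⇒ {n} {2 * hamming x y} δ≡2a)
      ... | inj₂ δ≡2b = [ inj₂ ∘ inj₂ ∘ inj₂ ∘ inj₁ , inj₂ ∘ inj₂ ∘ inj₂ ∘ inj₂ ∘ inj₁ ]′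
                          (∣n-t∣≡s⇒ {n} {2 * hamming x y} δ≡2b)

      all-distances : ∀ {x y} → x ∈ words union → y ∈ words union → InSet (2 * hamming x y)
      all-distances {x} {y} x∈ y∈ with ∈-++⁻ X x∈ | ∈-++⁻ X y∈
      ... | inj₁ x∈X | inj₁ y∈X = within (HX.distance x∈X y∈X)
      ... | inj₁ x∈X | inj₂ y∈Y = between x∈X y∈Y
      ... | inj₂ x∈Y | inj₁ y∈X = subst (InSet ∘ (2 *_)) (hamming-sym y x) (between y∈X x∈Y)
      ... | inj₂ x∈Y | inj₂ y∈Y = within (HY.distance x∈Y y∈Y)

      some-word : ∃[ x ] x ∈ words union
      some-word with x , _ , x∈X , _ ← attained₁ = x , ∈-++⁺ˡ x∈X

      cross-attained : ∀ {s t} → s ≤ n → ∃[ x ] ∃[ y ] (x ∈ X × y ∈ Y × δ x y ≡ s) →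
                       t ≡ n ∸ s ⊎ t ≡ n + s → Attained t
      cross-attained s≤n (x , y , x∈ , y∈ , δ≡s) t≡ =
        [ (λ 2h≡t → x , y , ∈-++⁺ˡ x∈ , ∈-++⁺ʳ X y∈ , 2h≡t)
        , (λ 2h≡t → x , complement y , ∈-++⁺ˡ x∈ , ∈-++⁺ʳ X (HY.closed y y∈) , 2h≡t)
        ]′ (δ-attains x y s≤n δ≡s t≡)

      2n∸2≢0 : 2 * n ∸ 2 ≢ 0
      -- The equation would give `n ≡ 1`, but `0 < 2 * a < n` makes `n` at least 2.
      2n∸2≢0 eq = <⇒≱ (≤-<-trans 0<2a 2a<n) (≤-reflexive (*-cancelˡ-≡ n 1 2
        (trans (sym (1+[2n∸2]+1 0<n)) (cong (λ k → 1 + k + 1) eq))))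

      A-half≢0 : ∀ m → 2 * m ≡ n → A m (words union) ≢ 0ℚ
      A-half≢0 m 2m≡n A≡0 with m*n≡0⇒m≡0∨n≡0 (2 * n ∸ 2)
        (trans (sym (A≡⁻ m (words union) (2 * n ∸ 2) (union-half m 2m≡n))) (A≡⁻ m (words union) 0 A≡0))
      ... | inj₁ eq = 2n∸2≢0 eq
      ... | inj₂ eq = <⇒≢ 0<length-union (sym eq)

      -- No pair is constructed: `A m` is `2 * n ∸ 2`, which is nonzero, so some pair at distance
      -- `m` exists.
      half-attained : Attained n
      half-attained with m , 2m≡n ← n-even
        with x , y , x∈ , y∈ , refl ← A≢0⁻ m (words union) (A-half≢0 m 2m≡n) = x , y , x∈ , y∈ , 2m≡n

      all-attained : ∀ {t} → InSet t → Attained t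
      all-attained (inj₁ refl) = let x , x∈ = some-word in x , x , x∈ , x∈ , cong (2 *_) (hamming-refl x)
      all-attained (inj₂ (inj₁ t≡)) = cross-attained (<⇒≤ 2a<n) attained₁ (inj₁ t≡)
      all-attained (inj₂ (inj₂ (inj₁ t≡))) = cross-attained (<⇒≤ 2a<n) attained₁ (inj₂ t≡)
      all-attained (inj₂ (inj₂ (inj₂ (inj₁ t≡)))) = cross-attained (<⇒≤ 2b<n) attained₂ (inj₁ t≡)
      all-attained (inj₂ (inj₂ (inj₂ (inj₂ (inj₁ t≡))))) = cross-attained (<⇒≤ 2b<n) attained₂ (inj₂ t≡)
      all-attained (inj₂ (inj₂ (inj₂ (inj₂ (inj₂ (inj₁ refl)))))) = half-attained
      all-attained (inj₂ (inj₂ (inj₂ (inj₂ (inj₂ (inj₂ refl)))))) = let x , x∈ = some-word in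
        x , complement x , x∈ , union-closed x x∈ , cong (2 *_) (hamming-self-complement x)

    union-DistanceSet : DistanceSet (words union) a b
    union-DistanceSet =
        (λ i _ → (λ A≢0 → let x , y , x∈ , y∈ , h≡i = A≢0⁻ i (words union) A≢0 in
                   subst (InSet ∘ (2 *_)) h≡i (all-distances x∈ y∈))
               , (λ 2i∈ A≡0 → let x , y , x∈ , y∈ , 2h≡2i = all-attained 2i∈ in
                   A≡0⁻ i (words union) A≡0 x∈ y∈ (*-cancelˡ-≡ _ i 2 2h≡2i)))
      , λ t t∈ → let x , y , _ , _ , 2h≡t = all-attained t∈ in hamming x y , hamming≤n x y , 2h≡t

  -- From a code to a cross spectrum.

  module _ {C X Y : List (Word n)} (unique-C : Unique C) (length-C : length C ≡ 4 * n)
           (distances : DistanceSet C a b)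
           (half : ∀ i → 2 * i ≡ n → A i C ≡ ℕ→ℚ (2 * n ∸ 2))
           (hX : HadamardCode X) (hY : HadamardCode Y)
           (C⇔X∪Y : ∀ x → (x ∈ C) ⇔ ((x ∈ X) ⊎ (x ∈ Y))) where

    private
      module HX = HadamardCode hX
      module HY = HadamardCode hY

      ∈C⇒ : ∀ {x} → x ∈ C → x ∈ X ⊎ x ∈ Y
      ∈C⇒ = Equivalence.to (C⇔X∪Y _)

      ⇒∈C : ∀ {x} → x ∈ X ⊎ x ∈ Y → x ∈ C
      ⇒∈C = Equivalence.from (C⇔X∪Y _)

      open import Data.List.Membership.DecPropositional (Vec.≡-dec {n = n} _≟ᵇ_) using (_∉?_; _∈?_)

      -- The hypothesis gives `C` as a union of sets only; removing a possible overlap first yields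
      -- a duplicate-free list to compare with `C`.
      Y∖X : List (Word n)
      Y∖X = filter (_∉? X) Y

      C↭X++Y∖X : C ↭ X ++ Y∖X
      C↭X++Y∖X = unique∧set⇒↭ unique-C
        (Unique.++⁺ HX.distinct (Unique.filter⁺ (_∉? X) HY.distinct)
          λ (z∈X , z∈Y∖X) → proj₂ (∈-filter⁻ (_∉? X) {xs = Y} z∈Y∖X) z∈X)
        λ x → mk⇔
          (λ x∈ → case x ∈? X of λ
            { (yes x∈X) → ∈-++⁺ˡ x∈X
            ; (no x∉X)  → ∈-++⁺ʳ X ([ (λ x∈X → contradiction x∈X x∉X)
                                    , (λ x∈Y → ∈-filter⁺ (_∉? X) x∈Y x∉X) ]′ (∈C⇒ x∈)) })
          (λ x∈ → ⇒∈C (⊎-map id (proj₁ ∘ ∈-filter⁻ (_∉? X)) (∈-++⁻ X x∈)))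

      -- |C| = |X| + |Y| leaves no room for an overlap.
      Y∖X≡Y : Y∖X ≡ Y
      Y∖X≡Y = filter-complete (_∉? X) (+-cancelˡ-≡ (2 * n) _ _ (begin
        2 * n + length Y∖X     ≡⟨ cong (λ k → k + length Y∖X) HX.card ⟨
        length X + length Y∖X  ≡⟨ length-++ X ⟨
        length (X ++ Y∖X)      ≡⟨ ↭.↭-length C↭X++Y∖X ⟨
        length C               ≡⟨ length-C ⟩
        4 * n                  ≡⟨ solve 1 (λ n → con 4 :* n := con 2 :* n :+ con 2 :* n) refl n ⟩
        2 * n + 2 * n          ≡⟨ cong (λ k → 2 * n + k) HY.card ⟨
        2 * n + length Y       ∎))
        where
        open ≡-Reasoning
        open +-*-Solver

      disjoint : ∀ {x} → x ∈ X → x ∉ Y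
      disjoint x∈X x∈Y = proj₂ (∈-filter⁻ (_∉? X) {xs = Y} (subst (_ ∈_) (sym Y∖X≡Y) x∈Y)) x∈X

      C↭X++Y : C ↭ X ++ Y
      C↭X++Y = subst (λ Z → C ↭ X ++ Z) Y∖X≡Y C↭X++Y∖X

      -- X and Y already account for all pairs at distance n/2.
      cross-half≡0 : ∀ m → 2 * m ≡ n → cross m X Y ≡ 0
      cross-half≡0 m 2m≡n = m+n≡0⇒m≡0 _ (+-cancelˡ-≡ (p X + p Y) _ _ (begin
        (p X + p Y) + (cross m X Y + cross m Y X)
          ≡⟨ solve 4 (λ u v w z → (u :+ v) :+ (w :+ z) := (u :+ w) :+ (z :+ v)) refl
               (p X) (p Y) (cross m X Y) (cross m Y X) ⟩
        (p X + cross m X Y) + (cross m Y X + p Y)  ≡⟨ pairCount-++ m {X} {Y} ⟨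
        p (X ++ Y)                                 ≡⟨ pairCount-↭ m C↭X++Y ⟨
        p C                                        ≡⟨ A≡⁻ m C (2 * n ∸ 2) (half m 2m≡n) ⟩
        (2 * n ∸ 2) * length C                     ≡⟨ cong ((2 * n ∸ 2) *_) (trans (↭.↭-length C↭X++Y) (length-++ X)) ⟩
        (2 * n ∸ 2) * (length X + length Y)        ≡⟨ *-distribˡ-+ (2 * n ∸ 2) (length X) (length Y) ⟩
        (2 * n ∸ 2) * length X + (2 * n ∸ 2) * length Y
          ≡⟨ cong₂ _+_ (pairCount-half 0<n hX 2m≡n) (pairCount-half 0<n hY 2m≡n) ⟨
        p X + p Y                                  ≡⟨ +-identityʳ _ ⟨
        p X + p Y + 0                              ∎))
        where
        open ≡-Reasoning
        open +-*-Solver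
        p : List (Word n) → ℕ
        p = pairCount m

      -- Of the seven admissible distances, 0 and `n` would put `x` or its complement in both
      -- halves, and `n/2` is ruled out by `cross-half≡0`.
      cross-values : ∀ {x y} → x ∈ X → y ∈ Y → δ x y ≡ 2 * a ⊎ δ x y ≡ 2 * b
      cross-values {x} {y} x∈ y∈
        with proj₁ (proj₁ distances (hamming x y) (hamming≤n x y))
               (λ A≡0 → A≡0⁻ _ C A≡0 (⇒∈C (inj₁ x∈)) (⇒∈C (inj₂ y∈)) refl)
      ... | inj₁ 2h≡0 = contradiction (subst (_∈ Y) (sym (hamming-≡0 x y (*-cancelˡ-≡ _ 0 2 2h≡0))) y∈) (disjoint x∈)
      ... | inj₂ (inj₁ eq) = inj₁ (trans (cong ∣ n -_∣ eq) (∣n-[n∸s]∣≡s (<⇒≤ 2a<n)))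
      ... | inj₂ (inj₂ (inj₁ eq)) = inj₁ (trans (cong ∣ n -_∣ eq) (∣m-m+n∣≡n n _))
      ... | inj₂ (inj₂ (inj₂ (inj₁ eq))) = inj₂ (trans (cong ∣ n -_∣ eq) (∣n-[n∸s]∣≡s (<⇒≤ 2b<n)))
      ... | inj₂ (inj₂ (inj₂ (inj₂ (inj₁ eq)))) = inj₂ (trans (cong ∣ n -_∣ eq) (∣m-m+n∣≡n n _))
      ... | inj₂ (inj₂ (inj₂ (inj₂ (inj₂ (inj₁ 2h≡n))))) =
        contradiction refl (cross-≡0⁻ (cross-half≡0 _ 2h≡n) x∈ y∈)
      ... | inj₂ (inj₂ (inj₂ (inj₂ (inj₂ (inj₂ 2h≡2n))))) =
        contradiction (subst (_∈ Y) (hamming-≡n x y (*-cancelˡ-≡ _ n 2 2h≡2n)) y∈) (disjoint (HX.closed x x∈))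

      within-∉ : ∀ {x y : Word n} {s} → s ≡ 2 * a ⊎ s ≡ 2 * b → δ x y ≡ s →
                 ¬ (y ≡ x ⊎ y ≡ complement x ⊎ 2 * hamming x y ≡ n)
      within-∉ {x} s∈ refl (inj₁ refl)        = δ-cross-≢n s∈ (δ-refl x)
      within-∉ {x} s∈ refl (inj₂ (inj₁ refl)) = δ-cross-≢n s∈ (trans (δ-complementʳ x x) (δ-refl x))
      within-∉ {x} {y} s∈ refl (inj₂ (inj₂ 2h≡n)) = δ-cross-≢0 s∈ (2h≡n⇒δ≡0 x y 2h≡n)

      -- Distance `(n - s)/2` occurs somewhere in `C`; inside a half `δ` is only `n` or 0, so the
      -- pair found must lie across the halves.
      cross-attained : ∀ {s} → s ≡ 2 * a ⊎ s ≡ 2 * b → s ≤ n → InDoubledSet n a b (n ∸ s) →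
                       ∃[ x ] ∃[ y ] (x ∈ X × y ∈ Y × δ x y ≡ s)
      cross-attained {s} s∈ s≤n t∈
        with i , i≤n , 2i≡ ← proj₂ distances (n ∸ s) t∈
        with x , y , x∈ , y∈ , refl ← A≢0⁻ i C (proj₂ (proj₁ distances i i≤n) (subst (InDoubledSet n a b) (sym 2i≡) t∈))
        with δ≡s ← trans (cong ∣ n -_∣ 2i≡) (∣n-[n∸s]∣≡s s≤n)
        with ∈C⇒ x∈ | ∈C⇒ y∈
      ... | inj₁ x∈X | inj₁ y∈X = contradiction (HX.distance x∈X y∈X) (within-∉ s∈ δ≡s)
      ... | inj₁ x∈X | inj₂ y∈Y = x , y , x∈X , y∈Y , δ≡s
      ... | inj₂ x∈Y | inj₁ y∈X = y , x , y∈X , x∈Y , trans (δ-sym y x) δ≡s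
      ... | inj₂ x∈Y | inj₂ y∈Y = contradiction (HY.distance x∈Y y∈Y) (within-∉ s∈ δ≡s)

    union-CrossSpectrum : CrossSpectrum X Y a b
    union-CrossSpectrum = record
      { values    = cross-values
      ; attained₁ = cross-attained (inj₁ refl) (<⇒≤ 2a<n) (inj₂ (inj₁ refl))
      ; attained₂ = cross-attained (inj₂ refl) (<⇒≤ 2b<n) (inj₂ (inj₂ (inj₂ (inj₁ refl))))
      }

  -- Passage between pairs of matrices and pairs of codes.

  HadamardPair : Set
  HadamardPair = ∃[ H ] ∃[ K ] (IsHadamard n H × IsHadamard n K × WeaklyUnbiased H K × σ≡ H K (2 * a) (2 * b))

  CodePair : Set
  CodePair = ∃[ X ] ∃[ Y ] (HadamardCode {n} X × HadamardCode Y × CrossSpectrum X Y a b)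

  HadamardPair⇒CodePair : HadamardPair → CodePair
  HadamardPair⇒CodePair (H , K , hH , hK , _ , σ⊆ , (i , j , ∣ij∣≡2a) , (k , l , ∣kl∣≡2b)) =
    signedRows (signRows H) , signedRows (signRows K) ,
    signedRows-HadamardCode 0<n (signRows-orthogonal hH) ,
    signedRows-HadamardCode 0<n (signRows-orthogonal hK) , record
      { values    = λ x∈ y∈ → let i , x≈ = ∈-signedRows⁻ x∈
                                  j , y≈ = ∈-signedRows⁻ y∈ in
                    σ⊆ _ (i , j , sym (trans (δ-cong-± x≈ y≈) (δ-signRows hH hK i j)))
      ; attained₁ = _ , _ , ∈-signedRows⁺ i (inj₁ refl) , ∈-signedRows⁺ j (inj₁ refl) ,
                    trans (δ-signRows hH hK i j) ∣ij∣≡2a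
      ; attained₂ = _ , _ , ∈-signedRows⁺ k (inj₁ refl) , ∈-signedRows⁺ l (inj₁ refl) ,
                    trans (δ-signRows hH hK k l) ∣kl∣≡2b
      }

  CodePair⇒HadamardPair : Odd a → Odd b → CodePair → HadamardPair
  CodePair⇒HadamardPair odd-a odd-b (X , Y , hX , hY , spectrum)
    with f , f⊥ , f∈X , X≈f ← representatives 0<n hX
    with g , g⊥ , g∈Y , Y≈g ← representatives 0<n hY =
    signMatrix f , signMatrix g , signMatrix-IsHadamard {f = f} f⊥ , signMatrix-IsHadamard {f = g} g⊥ ,
    ((λ i j → [ 4∣z-2 (f·gᵀ i j) odd-a , 4∣z-2 (f·gᵀ i j) odd-b ]′ (entries i j)) , (2 * a , 2 * b , entries) , biased) ,
    ((λ { _ (i , j , refl) → entries i j }) , 2a∈σ , 2b∈σ)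
    where
    open CrossSpectrum spectrum
    f·gᵀ = signMatrix f ·ᵀ signMatrix g

    entries : ∀ i j → ∣ f·gᵀ i j ∣ ≡ 2 * a ⊎ ∣ f·gᵀ i j ∣ ≡ 2 * b
    entries i j = ⊎-map (trans (∣signMatrix∣ f g i j)) (trans (∣signMatrix∣ f g i j)) (values (f∈X i) (g∈Y j))

    attained : ∀ {s} → ∃[ x ] ∃[ y ] (x ∈ X × y ∈ Y × δ x y ≡ s) → s ∈σ[ signMatrix f , signMatrix g ]
    attained (x , y , x∈ , y∈ , δ≡s) = let i , x≈ = X≈f x∈
                                           j , y≈ = Y≈g y∈ in
      i , j , trans (∣signMatrix∣ f g i j) (trans (sym (δ-cong-± x≈ y≈)) δ≡s)

    2a∈σ = attained attained₁
    2b∈σ = attained attained₂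

    -- Unbiasedness would give all entries the same square, but `2 * a` and `2 * b` both occur and
    -- have different squares.
    biased : ¬ Unbiased (signMatrix f) (signMatrix g)
    biased unbiased with i , j , ij≡ ← 2a∈σ | k , l , kl≡ ← 2b∈σ =
      <⇒≢ (*-mono-< 2a<2b 2a<2b)
        (trans (cong (λ z → z * z) (sym ij≡)) (trans (unbiased i j)
          (trans (sym (unbiased k l)) (cong (λ z → z * z) kl≡))))

theorem7p1 : (n a b : ℕ) → 0 < n → Odd a → Odd b → 0 < a → a < b → 2 * b < n →
    (∃[ C ] (SelfComplementary (words {n} {4 * n} C)
    × DistanceSet (words C) a b
    × (∀ i → 2 * i ≡ n → A i (words C) ≡ ℕ→ℚ (2 * n ∸ 2))
    × (∃[ M₁ ] ∃[ M₂ ] ∃[ C₁ ] ∃[ C₂ ] (HalfDistribution (words {n} {M₁} C₁)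
    × HalfDistribution (words {n} {M₂} C₂)
    × (∀ x → (x ∈ words C) ⇔ ((x ∈ words C₁) ⊎ (x ∈ words C₂)))))))
    ⇔ (∃[ H ] ∃[ K ] (IsHadamard n H × IsHadamard n K × WeaklyUnbiased H K
    × σ≡ H K (2 * a) (2 * b)))
theorem7p1 n a b 0<n odd-a odd-b 0<a a<b 2b<n = mk⇔ to from
  where
  to : _ → HadamardPair 0<n 0<a a<b 2b<n
  to (C , _ , distances , half , _ , _ , C₁ , C₂ , half₁ , half₂ , C⇔)
    -- The doubled set contains `n`, so the distance set already provides an integer `m` equal to
    -- `n/2`.
    with m , _ , 2m≡n ← proj₂ distances n (inj₂ (inj₂ (inj₂ (inj₂ (inj₂ (inj₁ refl)))))) =
    CodePair⇒HadamardPair 0<n 0<a a<b 2b<n odd-a odd-b (words C₁ , words C₂ , h₁ , h₂ ,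
      union-CrossSpectrum 0<n 0<a a<b 2b<n (unique C) (size C) distances half h₁ h₂ C⇔)
    where
    h₁ = HalfDistribution⇒HadamardCode 0<n {m = m} 2m≡n (unique C₁) half₁
    h₂ = HalfDistribution⇒HadamardCode 0<n {m = m} 2m≡n (unique C₂) half₂

  from : HadamardPair 0<n 0<a a<b 2b<n → _
  from pair with X , Y , hX , hY , spectrum ← HadamardPair⇒CodePair 0<n 0<a a<b 2b<n pair =
    union 0<n 0<a a<b 2b<n hX hY spectrum ,
    union-closed 0<n 0<a a<b 2b<n hX hY spectrum ,
    union-DistanceSet 0<n 0<a a<b 2b<n hX hY spectrum ,
    union-half 0<n 0<a a<b 2b<n hX hY spectrum ,
    -- The two sizes are read off from `refl` as the lengths of `X` and `Y`.
    _ , _ , mkCode X (HadamardCode.distinct hX) refl , mkCode Y (HadamardCode.distinct hY) refl ,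
    HadamardCode⇒HalfDistribution 0<n {X} hX , HadamardCode⇒HalfDistribution 0<n {Y} hY ,
    λ x → ++-∈⇔
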